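{- Let $G=(V,E)$ be a finite undirected simple graph. The algorithm ChordlessCycles$(G)$ (described in the context) enumerates all the chordless cycles of $G$; that is, it terminates and the set $C$ it returns is the set of all chordless cycles of $G$ (each cycle being represented by a vertex sequence, where sequences differing by rotation and/or reversal represent the same cycle).
   Context: $n=|V|$, and $Adj(x)=\{y\in V \mid (x,y)\in E\}$. A simple path is a finite sequence $\langle v_1,\dots,v_k\rangle$ of pairwise distinct vertices with consecutive vertices adjacent. A cycle is a simple path $\langle v_1,\dots,v_k\rangle$, $k\ge 3$, with $(v_k,v_1)\in E$ (the first vertex is not repeated at the end); rotations and reversals of the sequence describe the same cycle. A chord of a path (cycle) is an edge of $G$ between two of its vertices that is not an edge of the path (cycle). A chordless path (cycle) is one without a chord; triangles are chordless cycles. If $p=\langle u_1,\dots,u_t\rangle$, then $\langle p,v\rangle$ denotes $\langle u_1,\dots,u_t,v\rangle$. A vertex labeling is a bijection $\ell:V\to\{1,\dots,n\}$. The algorithm uses a degree labeling: put $G_1=G$; for $i\ge 1$ choose a vertex $u_i$ of minimum degree in $G_i$, set $\ell(u_i)=i$ and $G_{i+1}=G_i-u_i$. Algorithm ChordlessCycles$(G)$, with $\ell$ a degree labeling of $G$: 1. $T \leftarrow \{\langle x,u,y\rangle \mid x,u,y\in V,\ x,y\in Adj(u),\ \ell(u)<\ell(x)<\ell(y),\ (x,y)\notin E\}$. 2. $C \leftarrow \{\langle x,u,y\rangle \mid x,u,y\in V,\ x,y\in Adj(u),\ \ell(u)<\ell(x)<\ell(y),\ (x,y)\in E\}$. 3.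 While $T\ne\varnothing$: choose some $p=\langle u_1,u_2,\dots,u_t\rangle\in T$ and remove it from $T$; for each $v\in Adj(u_t)$ such that $\ell(v)>\ell(u_2)$ and $v\notin Adj(u_i)$ for all $i\in\{2,\dots,t-1\}$: if $v\in Adj(u_1)$, add $\langle p,v\rangle$ to $C$; otherwise add $\langle p,v\rangle$ to $T$. 4. Return $C$. -}

module Defs where

open import Data.Fin using (Fin; toℕ)
import Data.Fin as Fin
import Data.Fin.Properties as Fin
open import Data.Fin.Subset using (Subset; ⊤; Empty; _-_) renaming (_∈_ to _∈ₛ_)
open import Data.Fin.Subset.Properties using () renaming (_∈?_ to _∈ₛ?_)
open import Data.List.Base
  using (List; []; _∷_; _++_; _∷ʳ_; map; filter; length; head; last; drop; take;
         reverse; allFin; cartesianProduct)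
open import Data.List.Membership.Propositional using (_∈_)
open import Data.List.Properties using (≡-dec)
open import Data.List.Relation.Unary.All using (All; all?)
open import Data.List.Relation.Unary.Linked using (Linked)
open import Data.List.Relation.Unary.Unique.Propositional using (Unique)
open import Data.Maybe.Base using (just)
import Data.Maybe.Relation.Unary.Any as Maybe
open import Data.Nat.Base using (ℕ; suc; _∸_; _≤_)
open import Data.Product.Base using (_×_; _,_; ∃-syntax)
open import Data.Sum.Base using (_⊎_)
open import Function.Base using (flip)
open import Function.Bundles using (_⤖_; module Bijection)
open import Induction.WellFounded using (Acc)
open import Relation.Binary.Construct.Closure.ReflexiveTransitive using (Star)
open import Relation.Binary.PropositionalEquality using (_≡_)
open import Relation.Nullary using (¬_; Dec; ¬?; _×-dec_)

-- Finite undirected simple graphs on the vertex set Fin n.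
record Graph (n : ℕ) : Set₁ where
  infix 4 _~_ _~?_
  field
    _~_      : Fin n → Fin n → Set
    _~?_     : ∀ x y → Dec (x ~ y)
    ~-sym    : ∀ {x y} → x ~ y → y ~ x
    ~-irrefl : ∀ {x} → ¬ (x ~ x)

module _ {n : ℕ} (G : Graph n) where
  open Graph G

  Path : Set
  Path = List (Fin n)

  record IsSimplePath (p : Path) : Set where
    field
      distinct : Unique p
      adjacent : Linked _~_ p

  Consecutive : Path → Fin n → Fin n → Set
  Consecutive p x y = ∃[ as ] ∃[ bs ] p ≡ as ++ x ∷ y ∷ bs

  Closing : Path → Fin n → Fin n → Set
  Closing p x y = last p ≡ just x × head p ≡ just y

  record IsCycle (c : Path) : Set where
    field
      simplePath : IsSimplePath c
      length≥3   : 3 ≤ length c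
      closed     : ∃[ x ] ∃[ y ] Closing c x y × x ~ y

  CycleEdge : Path → Fin n → Fin n → Set
  CycleEdge c x y =
    (Consecutive c x y ⊎ Closing c x y) ⊎ (Consecutive c y x ⊎ Closing c y x)

  Chord : Path → Fin n → Fin n → Set
  Chord c x y = x ∈ c × y ∈ c × x ~ y × ¬ CycleEdge c x y

  record IsChordlessCycle (c : Path) : Set where
    field
      isCycle   : IsCycle c
      chordless : ∀ x y → ¬ Chord c x y

  Rotation : Path → Path → Set
  Rotation c d = ∃[ as ] ∃[ bs ] c ≡ as ++ bs × d ≡ bs ++ as

  SameCycle : Path → Path → Set
  SameCycle c d = Rotation c d ⊎ Rotation (reverse c) d

  -- Degree of u in the subgraph of G induced by S.
  degree : Subset n → Fin n → ℕ
  degree S u = length (filter (λ v → (v ∈ₛ? S) ×-dec (u ~? v)) (allFin n))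

  -- Labels are counted from 0: the element i of Fin n is the label i + 1.
  Labeling : Set
  Labeling = Fin n ⤖ Fin n

  -- S is the set of vertices still unlabeled when label i is to be assigned.
  data GreedyFrom (ℓ : Labeling) (i : ℕ) (S : Subset n) : Set where
    done   : Empty S → GreedyFrom ℓ i S
    choose : ∀ u → u ∈ₛ S →
             (∀ w → w ∈ₛ S → degree S u ≤ degree S w) →
             toℕ (Bijection.to ℓ u) ≡ i →
             GreedyFrom ℓ (suc i) (S - u) →
             GreedyFrom ℓ i S

  IsDegreeLabeling : Labeling → Set
  IsDegreeLabeling ℓ = GreedyFrom ℓ 0 ⊤

  module Algorithm (ℓ : Labeling) where

    infix 4 _≺_ _≺?_

    _≺_ : Fin n → Fin n → Set
    x ≺ y = Bijection.to ℓ x Fin.< Bijection.to ℓ y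

    _≺?_ : ∀ x y → Dec (x ≺ y)
    x ≺? y = Bijection.to ℓ x Fin.<? Bijection.to ℓ y

    Triple : Set
    Triple = Fin n × Fin n × Fin n

    toPath : Triple → Path
    toPath (x , u , y) = x ∷ u ∷ y ∷ []

    Ordered : Triple → Set
    Ordered (x , u , y) = (u ~ x × u ~ y) × (u ≺ x × x ≺ y)

    ordered? : ∀ t → Dec (Ordered t)
    ordered? (x , u , y) = ((u ~? x) ×-dec (u ~? y)) ×-dec ((u ≺? x) ×-dec (x ≺? y))

    EndsAdjacent : Triple → Set
    EndsAdjacent (x , u , y) = x ~ y

    endsAdjacent? : ∀ t → Dec (EndsAdjacent t)
    endsAdjacent? (x , u , y) = x ~? y

    orderedTriples : List Triple
    orderedTriples =
      filter ordered? (cartesianProduct (allFin n) (cartesianProduct (allFin n) (allFin n)))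

    -- ⟨u₂, …, uₜ₋₁⟩ for p = ⟨u₁, …, uₜ⟩.
    interior : Path → Path
    interior p = drop 1 (take (length p ∸ 1) p)

    -- In order: v ∈ Adj(uₜ); ℓ(v) > ℓ(u₂); v ∉ Adj(uᵢ) for 2 ≤ i ≤ t - 1.
    Extends : Path → Fin n → Set
    Extends p v =
      Maybe.Any (_~ v) (last p) ×
      Maybe.Any (_≺ v) (head (drop 1 p)) ×
      All (λ u → ¬ (u ~ v)) (interior p)

    extends? : ∀ p v → Dec (Extends p v)
    extends? p v =
      Maybe.dec (_~? v) (last p) ×-dec
      Maybe.dec (_≺? v) (head (drop 1 p)) ×-dec
      all? (λ u → ¬? (u ~? v)) (interior p)

    Closes : Path → Fin n → Set
    Closes p v = Maybe.Any (_~ v) (head p)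

    closes? : ∀ p v → Dec (Closes p v)
    closes? p v = Maybe.dec (_~? v) (head p)

    extensions : Path → List (Fin n)
    extensions p = filter (extends? p) (allFin n)

    newPaths newCycles : Path → List Path
    newPaths  p = map (p ∷ʳ_) (filter (λ v → ¬? (closes? p v)) (extensions p))
    newCycles p = map (p ∷ʳ_) (filter (closes? p) (extensions p))

    -- The sets T and C, as lists up to membership; accordingly, removing an
    -- element removes all its occurrences.
    State : Set
    State = List Path × List Path

    remove : Path → List Path → List Path
    remove p = filter (λ q → ¬? (≡-dec Fin._≟_ q p))

    initial : State
    initial =
      map toPath (filter (λ t → ¬? (endsAdjacent? t)) orderedTriples) ,
      map toPath (filter endsAdjacent? orderedTriples)

    -- One iteration of the while loop, for an arbitrary choice of p.  There is
    -- a step from every state in which T is nonempty.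
    infix 4 _⟶_
    data _⟶_ : State → State → Set where
      iterate : ∀ {T C} p → p ∈ T →
                (T , C) ⟶ (remove p T ++ newPaths p , C ++ newCycles p)

    -- Every execution of the loop is finite.
    Terminates : Set
    Terminates = Acc (flip _⟶_) initial

    Returns : List Path → Set
    Returns C = Star _⟶_ initial ([] , C)

  EnumeratesChordlessCycles : List Path → Set
  EnumeratesChordlessCycles C =
    (∀ c → c ∈ C → IsChordlessCycle c) ×
    (∀ c → IsChordlessCycle c → ∃[ d ] d ∈ C × SameCycle c d)

{-# OPTIONS --safe #-}

-- Rotated and possibly reversed, a chordless cycle ⟨x, u, y, …⟩ has its least
-- label at u and ℓ(x) < ℓ(y).  Its prefix ⟨x, u, y⟩ is then generated at the
-- start, and extending a prefix by the next vertex of the cycle passes every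
-- test of the loop: chordlessness makes that vertex nonadjacent to the interior
-- of the prefix, and adjacent to x exactly when the cycle is complete.
-- Conversely T only ever contains chordless paths: a neighbor v of the last
-- vertex that passes the tests is new, since x and all interior vertices except
-- u are adjacent to an interior vertex, and v = u is excluded by ℓ(v) > ℓ(u).
-- Paths in T therefore have length at most n, and the sum of (n + 1)^(n − |p|)
-- over T decreases.
module Submission where

open import Defs
open import Data.Nat.Base using (ℕ)
open import Data.Product.Base using (_×_)
open import Data.List.Base using (List)
open import Data.Empty using (⊥-elim)
open import Data.Fin.Base using (Fin)
import Data.Fin.Properties as Fin
open import Data.List.Base
  using ([]; _∷_; _++_; _∷ʳ_; length; head; last; take; map; filter;
         reverse; initLast; _∷ʳ′_; lookup; allFin; cartesianProduct)
open import Data.List.Membership.Propositional using (_∈_; _∉_)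
open import Data.List.Membership.Propositional.Properties
  using (∈-++⁺ˡ; ∈-++⁺ʳ; ∈-++⁻; ∈-∃++; ∈-allFin; ∈-cartesianProduct⁺; ∈-filter⁺; ∈-filter⁻;
         ∈-lookup; ∈-map⁻; ∈-map∘filter⁺; ∈-map∘filter⁻)
open import Data.List.Properties
  using (≡-dec; map-++; length-map; length-filter; length-tabulate; length-++; ++-assoc;
         ++-identityʳ; ∷-injective; ∷-injectiveˡ; ∷-injectiveʳ; ∷ʳ-++; unfold-reverse;
         reverse-++; reverse-involutive)
open import Data.List.Relation.Binary.Permutation.Propositional
  using (_↭_; ↭-sym; ↭-trans; ↭⇒↭ₛ)
open import Data.List.Relation.Binary.Permutation.Propositional.Properties
  using (↭-length; ∈-resp-↭; ↭-reverse; All-resp-↭; shift; ∷↭∷ʳ)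
  renaming (++-comm to ↭-++-comm)
import Data.List.Relation.Binary.Permutation.Setoid.Properties as Permₛ
open import Data.List.Relation.Unary.All as All using (All; []; _∷_)
import Data.List.Relation.Unary.All.Properties as All
open import Data.List.Relation.Unary.AllPairs using ([]; _∷_)
open import Data.List.Relation.Unary.Any using (here; there)
open import Data.List.Relation.Unary.Linked as Linked using (Linked; []; [-]; _∷_)
import Data.List.Relation.Unary.Linked.Properties as Linked
open import Data.List.Relation.Unary.Unique.Propositional using (Unique)
import Data.List.Relation.Unary.Unique.Propositional.Properties as Unique
open import Data.Maybe.Base using (just)
open import Data.Maybe.Properties using (just-injective)
open import Data.Maybe.Relation.Binary.Connected using (Connected; just)
import Data.Maybe.Relation.Unary.Any as Maybe
open import Data.Nat.Base
  using (suc; _+_; _*_; _∸_; _^_; _≤_; _<_; z≤n; s≤s)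
open import Data.Nat.Induction using (<-wellFounded)
open import Data.Nat.ListAction using (sum)
open import Data.Nat.ListAction.Properties using (sum-++)
open import Data.Nat.Properties as ℕ using (module ≤-Reasoning)
open import Data.Product.Base using (_,_; proj₁; proj₂; ∃-syntax)
open import Data.Sum.Base using (_⊎_; inj₁; inj₂; swap) renaming (map to ⊎-map)
open import Function.Base using (_∘_; flip; id)
open import Function.Bundles using (module Bijection)
open import Induction.WellFounded using (Acc; acc)
open import Relation.Binary.Construct.Closure.ReflexiveTransitive using (Star; ε; _◅_)
open import Relation.Binary.Definitions using (tri<; tri≈; tri>)
open import Relation.Binary.PropositionalEquality
open import Relation.Nullary using (¬_; Dec; yes; no; ¬?)

-- Lists: last elements, overlapping factorizations, lists without repetition.

module _ {A : Set} where

  private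
    variable
      x : A
      p q as bs cs ds : List A

  last-∷ʳ : ∀ p → last (p ∷ʳ x) ≡ just x
  last-∷ʳ []          = refl
  last-∷ʳ (_ ∷ [])    = refl
  last-∷ʳ (_ ∷ y ∷ p) = last-∷ʳ (y ∷ p)

  last-++-∷ : ∀ p → last (p ++ x ∷ q) ≡ last (x ∷ q)
  last-++-∷ []          = refl
  last-++-∷ (_ ∷ [])    = refl
  last-++-∷ (_ ∷ y ∷ p) = last-++-∷ (y ∷ p)

  last-∷ : ∀ (x : A) p → ∃[ z ] last (x ∷ p) ≡ just z
  last-∷ x []      = x , refl
  last-∷ x (y ∷ p) = last-∷ y p

  last-∈ : ∀ p → last p ≡ just x → x ∈ p
  last-∈ (_ ∷ [])    refl = here refl
  last-∈ (_ ∷ y ∷ p) eq   = there (last-∈ (y ∷ p) eq)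

  last-split : ∀ p → last p ≡ just x → ∃[ q ] p ≡ q ∷ʳ x
  last-split p eq with initLast p
  last-split _ () | []
  last-split _ eq | q ∷ʳ′ y = q , cong (q ∷ʳ_) (just-injective (trans (sym (last-∷ʳ q)) eq))

  head-split : ∀ p → head p ≡ just x → ∃[ q ] p ≡ x ∷ q
  head-split (_ ∷ q) refl = q , refl

  take-length-++ : ∀ p → take (length p) (p ++ q) ≡ p
  take-length-++ []      = refl
  take-length-++ (x ∷ p) = cong (x ∷_) (take-length-++ p)

  -- Of two cuts of the same list one comes no later than the other, and `k` is the stretch between
  -- them. This is what composing two rotations needs.
  ++-overlap : ∀ as cs → as ++ bs ≡ cs ++ ds →
               (∃[ k ] as ≡ cs ++ k × ds ≡ k ++ bs) ⊎
               (∃[ k ] cs ≡ as ++ k × bs ≡ k ++ ds)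
  ++-overlap []       cs       eq = inj₂ (cs , refl , eq)
  ++-overlap (a ∷ as) []       eq = inj₁ (a ∷ as , refl , sym eq)
  ++-overlap (a ∷ as) (c ∷ cs) eq with refl , eq′ ← ∷-injective eq
    with ++-overlap as cs eq′
  ... | inj₁ (k , refl , e) = inj₁ (k , refl , e)
  ... | inj₂ (k , refl , e) = inj₂ (k , refl , e)

  unique-∉ : Unique (x ∷ p) → x ∉ p
  unique-∉ = Unique.Unique[x∷xs]⇒x∉xs

  unique-∉ʳ : ∀ as → Unique (as ++ x ∷ bs) → x ∉ bs
  unique-∉ʳ []       u       = unique-∉ u
  unique-∉ʳ (_ ∷ as) (_ ∷ u) = unique-∉ʳ as u

  unique-disjoint : ∀ as → Unique (as ++ bs) → x ∈ as → x ∉ bs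
  unique-disjoint (_ ∷ as) u       (here refl) i = unique-∉ u (∈-++⁺ʳ as i)
  unique-disjoint (_ ∷ as) (_ ∷ u) (there j)   i = unique-disjoint as u j i

  -- An element that occurs only once fixes the place of the cut. Two descriptions of where a vertex
  -- sits on a cycle can therefore be identified.
  unique-split : ∀ as cs → Unique (as ++ x ∷ bs) →
                 as ++ x ∷ bs ≡ cs ++ x ∷ ds → as ≡ cs × bs ≡ ds
  unique-split []       []       u       eq   = refl , ∷-injectiveʳ eq
  unique-split []       (_ ∷ cs) u       refl = ⊥-elim (unique-∉ u (∈-++⁺ʳ cs (here refl)))
  unique-split (_ ∷ as) []       u       refl = ⊥-elim (unique-∉ u (∈-++⁺ʳ as (here refl)))
  unique-split (a ∷ as) (c ∷ cs) (_ ∷ u) eq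
    with refl , eq′ ← ∷-injective eq
    with refl , e ← unique-split as cs u eq′ = refl , e

  unique-resp-↭ : p ↭ q → Unique p → Unique q
  unique-resp-↭ r = Permₛ.Unique-resp-↭ (setoid A) (↭⇒↭ₛ r)

  unique-∷ʳ : Unique p → x ∉ p → Unique (p ∷ʳ x)
  unique-∷ʳ {p = p} {x = x} u x∉p =
    unique-resp-↭ (∷↭∷ʳ x p)
      (All.tabulate (λ i eq → x∉p (subst (_∈ p) (sym eq) i)) ∷ u)

  unique-lookup-injective : Unique p → ∀ i j → lookup p i ≡ lookup p j → i ≡ j
  unique-lookup-injective {p = _ ∷ p} u Fin.zero Fin.zero eq = refl
  unique-lookup-injective {p = _ ∷ p} u Fin.zero (Fin.suc j) eq =
    ⊥-elim (unique-∉ u (subst (_∈ p) (sym eq) (∈-lookup j)))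
  unique-lookup-injective {p = _ ∷ p} u (Fin.suc i) Fin.zero eq =
    ⊥-elim (unique-∉ u (subst (_∈ p) eq (∈-lookup i)))
  unique-lookup-injective (_ ∷ u) (Fin.suc i) (Fin.suc j) eq =
    cong Fin.suc (unique-lookup-injective u i j eq)

-- Pigeonhole: looking up positions is an injection into `Fin n`.
unique-length≤ : ∀ {n} {p : List (Fin n)} → Unique p → length p ≤ n
unique-length≤ u = Fin.injective⇒≤ (unique-lookup-injective u _ _)

-- A strict bound on sums, for the termination measure.

sum-scaled≤ : ∀ k {w} {xs : List ℕ} → All (λ x → k * x ≤ w) xs → k * sum xs ≤ length xs * w
sum-scaled≤ k []                       = ℕ.≤-reflexive (ℕ.*-zeroʳ k)
sum-scaled≤ k {w} {x ∷ xs} (le ∷ les)  = begin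
  k * (x + sum xs)      ≡⟨ ℕ.*-distribˡ-+ k x (sum xs) ⟩
  k * x + k * sum xs    ≤⟨ ℕ.+-mono-≤ le (sum-scaled≤ k les) ⟩
  w + length xs * w     ∎
  where open ≤-Reasoning

-- At most `N` terms, each at most `w / (N + 1)`, add up to at most `N w / (N + 1)`, which is below
-- `w` because `w` is positive. Multiplying through by `suc N` avoids division.
sum-< : ∀ {N w} {xs : List ℕ} → All (λ x → suc N * x ≤ w) xs → length xs ≤ N → 0 < w →
        sum xs < w
sum-< {N} {w} {xs} le len w>0 = ℕ.*-cancelˡ-< (suc N) (sum xs) w (begin-strict
  suc N * sum xs   ≤⟨ sum-scaled≤ (suc N) le ⟩
  length xs * w    ≤⟨ ℕ.*-monoˡ-≤ w len ⟩
  N * w            <⟨ ℕ.m<n+m (N * w) w>0 ⟩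
  suc N * w        ∎)
  where open ≤-Reasoning

-- Consecutive vertices of a path.

module _ {n : ℕ} (G : Graph n) where
  open Graph G

  private
    variable
      a b x v w : Fin n
      c d e p : Path G

  -- An oriented cycle edge: `CycleEdge G c a b` unfolds to `Step c a b ⊎ Step c b a`. Rotation
  -- keeps the orientation and reversal flips it.
  Step : Path G → Fin n → Fin n → Set
  Step c a b = Consecutive G c a b ⊎ Closing G c a b

  consecutive-∷ : Consecutive G p a b → Consecutive G (x ∷ p) a b
  consecutive-∷ (as , bs , eq) = _ ∷ as , bs , cong (_ ∷_) eq

  consecutive-++ʳ : ∀ q → Consecutive G p a b → Consecutive G (p ++ q) a b
  consecutive-++ʳ q (as , bs , refl) = as , bs ++ q , ++-assoc as _ q

  consecutive-last : ∀ p → last p ≡ just a → Consecutive G (p ∷ʳ b) a b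
  consecutive-last p eq with q , refl ← last-split p eq = q , [] , ∷ʳ-++ q _ _

  linked⇒~ : Linked _~_ p → Consecutive G p a b → a ~ b
  linked⇒~ (r ∷ _) ([] , _ , refl)         = r
  linked⇒~ [-]     (_ ∷ [] , _ , ())
  linked⇒~ [-]     (_ ∷ _ ∷ _ , _ , ())
  linked⇒~ (_ ∷ l) (_ ∷ as , bs , eq)      = linked⇒~ l (as , bs , ∷-injectiveʳ eq)

  ~⇒linked : (∀ {a b} → Consecutive G p a b → a ~ b) → Linked _~_ p
  ~⇒linked {p = []}        f = []
  ~⇒linked {p = x ∷ []}    f = [-]
  ~⇒linked {p = x ∷ y ∷ p} f = f ([] , p , refl) ∷ ~⇒linked (f ∘ consecutive-∷)

  consecutive-predecessor : v ∈ p → ∃[ w ] w ∈ x ∷ p × Consecutive G (x ∷ p) w v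
  consecutive-predecessor {x = x} (here refl) = x , here refl , [] , _ , refl
  consecutive-predecessor (there i) with w , j , k ← consecutive-predecessor i =
    w , there j , consecutive-∷ k

  -- Cyclic sequences up to rotation and reversal

  -- Moving the head to the end turns the pair leaving the head into the closing pair, and the
  -- former closing pair into the last consecutive pair.
  step-rotate₁ : ∀ p → Step (x ∷ p) a b → Step (p ∷ʳ x) a b
  step-rotate₁ p (inj₁ ([] , bs , refl)) = inj₂ (last-∷ʳ p , refl)
  step-rotate₁ p (inj₁ (_ ∷ as , bs , refl)) =
    inj₁ (consecutive-++ʳ _ (as , bs , refl))
  step-rotate₁ []      (inj₂ (refl , refl)) = inj₂ (refl , refl)
  step-rotate₁ (y ∷ p) (inj₂ (eq , refl))   = inj₁ (consecutive-last (y ∷ p) eq)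

  step-rotate : ∀ p q → Step (p ++ q) a b → Step (q ++ p) a b
  step-rotate []      q s = subst (λ c → Step c _ _) (sym (++-identityʳ q)) s
  step-rotate (x ∷ p) q s =
    subst (λ c → Step c _ _) (∷ʳ-++ q x p)
      (step-rotate p (q ∷ʳ x)
        (subst (λ c → Step c _ _) (++-assoc p q (x ∷ [])) (step-rotate₁ (p ++ q) s)))

  step-reverse : Step c a b → Step (reverse c) b a
  step-reverse {a = a} {b = b} (inj₁ (as , bs , refl)) =
    inj₁ (reverse bs , reverse as , (begin
      reverse (as ++ a ∷ b ∷ bs)                ≡⟨ reverse-++ as (a ∷ b ∷ bs) ⟩
      reverse (a ∷ b ∷ bs) ++ reverse as        ≡⟨ cong (_++ reverse as) (reverse-++ (a ∷ b ∷ []) bs) ⟩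
      (reverse bs ++ b ∷ a ∷ []) ++ reverse as  ≡⟨ ++-assoc (reverse bs) _ _ ⟩
      reverse bs ++ b ∷ a ∷ reverse as          ∎))
    where open ≡-Reasoning
  step-reverse {c = c} {a = a} {b = b} (inj₂ (l , h))
    with q , refl ← head-split c h =
    inj₂ ( trans (cong last (unfold-reverse b q)) (last-∷ʳ (reverse q))
         , first )
    where
    first : head (reverse (b ∷ q)) ≡ just a
    first with r , eq ← last-split (b ∷ q) l =
      trans (cong (head ∘ reverse) eq) (cong head (reverse-++ r (a ∷ [])))

  cycleEdge-rotate : ∀ p q → CycleEdge G (p ++ q) a b → CycleEdge G (q ++ p) a b
  cycleEdge-rotate p q = ⊎-map (step-rotate p q) (step-rotate p q)

  cycleEdge-reverse : CycleEdge G c a b → CycleEdge G (reverse c) a b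
  cycleEdge-reverse = swap ∘ ⊎-map step-reverse step-reverse

  -- Chordless cycles and their invariance under rotation and reversal.

  cycleEdge-adjacent : IsChordlessCycle G c → CycleEdge G c a b → a ~ b
  cycleEdge-adjacent {c = c} cc = λ where
      (inj₁ s) → step s
      (inj₂ s) → ~-sym (step s)
    where
    open IsChordlessCycle cc
    open IsCycle isCycle
    step : Step c a b → a ~ b
    step (inj₁ k) = linked⇒~ (IsSimplePath.adjacent simplePath) k
    step (inj₂ (l , h)) with x , y , (l′ , h′) , r ← closed =
      subst₂ _~_ (just-injective (trans (sym l′) l)) (just-injective (trans (sym h′) h)) r

  closingPair : ∀ c → 1 ≤ length c → ∃[ x ] ∃[ y ] Closing G c x y
  closingPair (x ∷ c) _ with z , eq ← last-∷ x c = z , x , eq , refl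

  -- Linkedness and closedness are merged into one hypothesis on `CycleEdge`, the form that survives
  -- rotation and reversal.
  chordlessCycle : Unique c → 3 ≤ length c →
                   (∀ {a b} → CycleEdge G c a b → a ~ b) →
                   (∀ a b → ¬ Chord G c a b) → IsChordlessCycle G c
  chordlessCycle {c = c} uniq len edge chord = record
    { isCycle = record
      { simplePath = record
        { distinct = uniq
        ; adjacent = ~⇒linked (λ k → edge (inj₁ (inj₁ k)))
        }
      ; length≥3 = len
      ; closed   = closed
      }
    ; chordless = chord
    }
    where
    closed : ∃[ x ] ∃[ y ] Closing G c x y × x ~ y
    closed with x , y , k ← closingPair c (ℕ.≤-trans (s≤s z≤n) len) =
      x , y , k , edge (inj₁ (inj₂ k))

  module _ (cc : IsChordlessCycle G c) where
    open IsChordlessCycle cc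
    open IsCycle isCycle
    open IsSimplePath simplePath

    chordlessCycle-resp :
      c ↭ d →
      (∀ {a b} → CycleEdge G c a b → CycleEdge G d a b) →
      (∀ {a b} → CycleEdge G d a b → CycleEdge G c a b) →
      IsChordlessCycle G d
    chordlessCycle-resp c↭d to from =
      chordlessCycle (unique-resp-↭ c↭d distinct)
        (subst (3 ≤_) (↭-length c↭d) length≥3)
        (cycleEdge-adjacent cc ∘ from)
        (λ a b (i , j , r , ¬e) →
          chordless a b ( ∈-resp-↭ (↭-sym c↭d) i , ∈-resp-↭ (↭-sym c↭d) j
                        , r , ¬e ∘ to))

    chordlessCycle-reverse : IsChordlessCycle G (reverse c)
    chordlessCycle-reverse =
      chordlessCycle-resp (↭-sym (↭-reverse c)) cycleEdge-reverse
        -- Reversal is an involution, so the converse direction is the same lemma applied to the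
        -- reversed cycle.
        (subst (λ e → CycleEdge G e _ _) (reverse-involutive c) ∘ cycleEdge-reverse)

    chordlessCycle-rotate : Rotation G c d → IsChordlessCycle G d
    chordlessCycle-rotate (p , q , refl , refl) =
      chordlessCycle-resp (↭-++-comm p q) (cycleEdge-rotate p q) (cycleEdge-rotate q p)

    -- The side condition says that the pair w, v is not the closing pair of c.
    separated⇒≁ : ∀ as {b} cs {ds} → c ≡ as ++ w ∷ b ∷ cs ++ v ∷ ds →
                  ¬ (as ≡ [] × ds ≡ []) → ¬ w ~ v
    separated⇒≁ {w = w} {v = v} as {b} cs {ds} refl ¬ends r =
      chordless w v (∈-++⁺ʳ as (here refl) , ∈-++⁺ʳ as (there v∈) , r , ¬edge)
      where
      v∈ : v ∈ b ∷ cs ++ v ∷ ds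
      v∈ = there (∈-++⁺ʳ cs (here refl))

      ¬edge : ¬ CycleEdge G c w v
      -- As `w` occurs once, its successor is `b`; so `v` would equal `b` and occur twice.
      ¬edge (inj₁ (inj₁ (as′ , bs′ , eq)))
        with refl , eq′ ← unique-split as as′ distinct eq
        with refl ← ∷-injectiveˡ eq′ =
        unique-∉ʳ (as ∷ʳ w) (subst Unique (sym (∷ʳ-++ as w _)) distinct)
          (∈-++⁺ʳ cs (here refl))
      ¬edge (inj₁ (inj₂ (l , _))) =
        unique-∉ʳ as distinct (last-∈ _ (trans (sym (last-++-∷ as)) l))
      -- Here `v` would precede `w`, hence lie in `as` as well as after `w`.
      ¬edge (inj₂ (inj₁ (as′ , bs′ , eq)))
        with refl , _ ← unique-split as (as′ ∷ʳ v) distinct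
                          (trans eq (sym (∷ʳ-++ as′ v _))) =
        unique-disjoint as distinct (∈-++⁺ʳ as′ (here refl)) (there v∈)
      -- The closing pair from `v` to `w` forces both outer parts to be empty, against the side
      -- condition.
      ¬edge (inj₂ (inj₂ (l , h))) = ¬closing as ds distinct l h ¬ends
        where
        ¬closing : ∀ as ds → let c = as ++ w ∷ b ∷ cs ++ v ∷ ds in
                   Unique c → last c ≡ just v → head c ≡ just w →
                   ¬ ¬ (as ≡ [] × ds ≡ [])
        ¬closing (_ ∷ as) ds       u l refl ¬ends = unique-∉ u (∈-++⁺ʳ as (here refl))
        ¬closing []       []       u l refl ¬ends = ¬ends (refl , refl)
        ¬closing []       (d ∷ ds) u l refl ¬ends =
          unique-∉ʳ (w ∷ b ∷ cs) u (last-∈ _ (trans (sym (last-++-∷ (w ∷ b ∷ cs))) l))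

  -- The second cut falls on one side or the other of the seam left by the first; either way a
  -- single cut of `c` gives `e`.
  rotation-trans : Rotation G c d → Rotation G d e → Rotation G c e
  rotation-trans (P , Q , refl , refl) (R , S , eq , refl)
    with ++-overlap Q R eq
  ... | inj₁ (k , refl , refl) = P ++ R , k , sym (++-assoc P R k) , ++-assoc k P R
  ... | inj₂ (k , refl , refl) = k , S ++ Q , ++-assoc k S Q , sym (++-assoc S Q k)

  rotation-reverse : Rotation G c d → Rotation G (reverse c) (reverse d)
  rotation-reverse (p , q , refl , refl) =
    reverse q , reverse p , reverse-++ p q , reverse-++ q p

module _ {n : ℕ} (G : Graph n) (ℓ : Labeling G) where
  open Graph G
  open Algorithm G ℓ

  private
    variable
      a b x y z u v w : Fin n
      c p q m : Path G
      T C : List (Path G)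

  -- The order of labels, and arcs with their extensions.

  ≺-irrefl : ¬ u ≺ u
  ≺-irrefl = Fin.<-irrefl refl

  ≺-distinct : u ≺ v → u ≢ v
  ≺-distinct r refl = ≺-irrefl r

  -- Injectivity of the labeling excludes equal labels from the trichotomy.
  ≺-connex : u ≢ v → u ≺ v ⊎ v ≺ u
  ≺-connex {u} {v} u≢v with Fin.<-cmp (Bijection.to ℓ u) (Bijection.to ℓ v)
  ... | tri< r _ _ = inj₁ r
  ... | tri≈ _ e _ = ⊥-elim (u≢v (Bijection.injective ℓ e))
  ... | tri> _ _ r = inj₂ r

  interior-∷-∷ʳ : ∀ x m z → interior (x ∷ m ∷ʳ z) ≡ m
  interior-∷-∷ʳ x m z
    rewrite length-++ m {z ∷ []} | ℕ.+-comm (length m) 1 = take-length-++ m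

  -- The paths ⟨x, u, …, z⟩ whose only possible chord is the closing edge z x.
  record IsArc (x u : Fin n) (m : Path G) (z : Fin n) : Set where
    field
      unique : Unique (x ∷ u ∷ m ∷ʳ z)
      linked : Linked _~_ (x ∷ u ∷ m ∷ʳ z)
      edges  : ∀ {a b} → a ∈ x ∷ u ∷ m ∷ʳ z → b ∈ x ∷ u ∷ m ∷ʳ z → a ~ b →
               CycleEdge G (x ∷ u ∷ m ∷ʳ z) a b

  -- On three vertices every pair of distinct vertices is consecutive or closing, so no edge can be
  -- a chord.
  triple-arc : Ordered (x , u , y) → IsArc x u [] y
  triple-arc {x} {u} {y} ((u~x , u~y) , (u≺x , x≺y)) = record
    { unique = ((≺-distinct u≺x ∘ sym) ∷ ≺-distinct x≺y ∷ []) ∷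
               (≺-distinct (Fin.<-trans u≺x x≺y) ∷ []) ∷ [] ∷ []
    ; linked = ~-sym u~x ∷ u~y ∷ [-]
    ; edges  = edges
    }
    where
    edges : a ∈ x ∷ u ∷ y ∷ [] → b ∈ x ∷ u ∷ y ∷ [] → a ~ b →
            CycleEdge G (x ∷ u ∷ y ∷ []) a b
    edges (here refl) (here refl) r = ⊥-elim (~-irrefl r)
    edges (here refl) (there (here refl)) r = inj₁ (inj₁ ([] , _ , refl))
    edges (here refl) (there (there (here refl))) r = inj₂ (inj₂ (refl , refl))
    edges (there (here refl)) (here refl) r = inj₂ (inj₁ ([] , _ , refl))
    edges (there (here refl)) (there (here refl)) r = ⊥-elim (~-irrefl r)
    edges (there (here refl)) (there (there (here refl))) r = inj₁ (inj₁ (x ∷ [] , [] , refl))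
    edges (there (there (here refl))) (here refl) r = inj₁ (inj₂ (refl , refl))
    edges (there (there (here refl))) (there (here refl)) r = inj₂ (inj₁ (x ∷ [] , [] , refl))
    edges (there (there (here refl))) (there (there (here refl))) r = ⊥-elim (~-irrefl r)

  -- The closing pair is the only cycle edge whose adjacency `linked` does not provide.
  closed-arc : IsArc x u m z → z ~ x → IsChordlessCycle G (x ∷ u ∷ m ∷ʳ z)
  closed-arc {x} {u} {m} {z} arc z~x =
    chordlessCycle G unique length≥3
      (λ where
        (inj₁ s) → step s
        (inj₂ s) → ~-sym (step s))
      (λ a b (i , j , r , ¬e) → ¬e (edges i j r))
    where
    open IsArc arc
    length≥3 : 3 ≤ length (x ∷ u ∷ m ∷ʳ z)
    length≥3 rewrite length-++ m {z ∷ []} | ℕ.+-comm (length m) 1 =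
      s≤s (s≤s (s≤s z≤n))
    step : Step G (x ∷ u ∷ m ∷ʳ z) a b → a ~ b
    step (inj₁ k) = linked⇒~ G linked k
    step (inj₂ (l , refl)) =
      subst (_~ x) (just-injective (trans (sym (last-∷ʳ (x ∷ u ∷ m))) l)) z~x

  -- The tests leave `z` and `x` as the only possible old neighbors of `v`; the first gives a
  -- consecutive pair, the second the new closing pair. The old closing pair is no longer a cycle
  -- edge, whence the hypothesis on `x` and `z`.
  arc-extend : IsArc x u m z → ¬ x ~ z → Extends (x ∷ u ∷ m ∷ʳ z) v →
               IsArc x u (m ∷ʳ z) v
  arc-extend {x} {u} {m} {z} {v} arc x≁z (last~v , Maybe.just u≺v , interior≁v) = record
    { unique = unique-∷ʳ unique v∉p
    ; linked = Linked.++⁺ linked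
        (subst (λ l → Connected _~_ l (just v)) (sym (last-∷ʳ (x ∷ u ∷ m))) (just z~v)) [-]
    ; edges  = edges′
    }
    where
    open IsArc arc

    z~v : z ~ v
    z~v with Maybe.just r ← subst (Maybe.Any (_~ v)) (last-∷ʳ (x ∷ u ∷ m)) last~v = r

    ≁v : w ∈ u ∷ m → ¬ w ~ v
    ≁v = All.lookup (subst (All _) (interior-∷-∷ʳ x (u ∷ m) z) interior≁v)

    ∈-cases : w ∈ x ∷ u ∷ m ∷ʳ z → w ≡ x ⊎ w ∈ u ∷ m ⊎ w ≡ z
    ∈-cases (here e) = inj₁ e
    ∈-cases (there i) with ∈-++⁻ (u ∷ m) i
    ... | inj₁ j        = inj₂ (inj₁ j)
    ... | inj₂ (here e) = inj₂ (inj₂ e)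

    v∉p : v ∉ x ∷ u ∷ m ∷ʳ z
    v∉p i with ∈-cases i
    ... | inj₁ refl                    = ≁v (here refl) (~-sym (Linked.head linked))
    ... | inj₂ (inj₁ (here refl))      = ≺-irrefl u≺v
    ... | inj₂ (inj₂ refl)             = ~-irrefl z~v
    -- A vertex of `m` is adjacent to its predecessor in `u ∷ m`, which the interior test forbids
    -- for `v`.
    ... | inj₂ (inj₁ (there j)) with w , k , c ← consecutive-predecessor G j =
      ≁v k (linked⇒~ G (Linked.tail linked) (consecutive-++ʳ G (z ∷ []) c))

    new : w ∈ x ∷ u ∷ m ∷ʳ z → w ~ v → Step G (x ∷ u ∷ (m ∷ʳ z) ∷ʳ v) w v ⊎
                                        Step G (x ∷ u ∷ (m ∷ʳ z) ∷ʳ v) v w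
    new i r with ∈-cases i
    ... | inj₁ refl        = inj₂ (inj₂ (last-∷ʳ (x ∷ u ∷ m ∷ʳ z) , refl))
    ... | inj₂ (inj₁ j)    = ⊥-elim (≁v j r)
    ... | inj₂ (inj₂ refl) = inj₁ (inj₁ (consecutive-last G (x ∷ u ∷ m ∷ʳ z) (last-∷ʳ (x ∷ u ∷ m))))

    old : Step G (x ∷ u ∷ m ∷ʳ z) a b → a ~ b → Step G (x ∷ u ∷ (m ∷ʳ z) ∷ʳ v) a b
    old (inj₁ k) r = inj₁ (consecutive-++ʳ G (v ∷ []) k)
    old (inj₂ (l , refl)) r =
      ⊥-elim (x≁z (~-sym (subst (_~ x) (just-injective (trans (sym l) (last-∷ʳ (x ∷ u ∷ m)))) r)))

    edges′ : a ∈ x ∷ u ∷ (m ∷ʳ z) ∷ʳ v → b ∈ x ∷ u ∷ (m ∷ʳ z) ∷ʳ v → a ~ b →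
             CycleEdge G (x ∷ u ∷ (m ∷ʳ z) ∷ʳ v) a b
    edges′ i j r with ∈-++⁻ (x ∷ u ∷ m ∷ʳ z) i | ∈-++⁻ (x ∷ u ∷ m ∷ʳ z) j
    ... | inj₂ (here refl) | inj₂ (here refl) = ⊥-elim (~-irrefl r)
    ... | inj₂ (here refl) | inj₁ j′          = swap (new j′ (~-sym r))
    ... | inj₁ i′          | inj₂ (here refl) = new i′ r
    ... | inj₁ i′          | inj₁ j′ with edges i′ j′ r
    ...   | inj₁ s = inj₁ (old s r)
    ...   | inj₂ s = inj₂ (old s (~-sym r))

  -- Soundness as a loop invariant.

  nonclosing? : ∀ p v → Dec (¬ Closes p v)
  nonclosing? p v = ¬? (closes? p v)

  endsNonadjacent? : ∀ t → Dec (¬ EndsAdjacent t)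
  endsNonadjacent? t = ¬? (endsAdjacent? t)

  ≢? : (p q : Path G) → Dec (q ≢ p)
  ≢? p q = ¬? (≡-dec Fin._≟_ q p)

  -- The invariant for `T`: nonadjacent ends rule out the one chord an arc may have, so these are
  -- chordless paths.
  data Candidate : Path G → Set where
    candidate : IsArc x u m z → ¬ x ~ z → Candidate (x ∷ u ∷ m ∷ʳ z)

  candidate-unique : Candidate p → Unique p
  candidate-unique (candidate arc _) = IsArc.unique arc

  newPaths-candidate : Candidate p → q ∈ newPaths p → Candidate q
  newPaths-candidate {p = p} (candidate arc x≁z) i
    with v , j , refl , ¬cl ← ∈-map∘filter⁻ (p ∷ʳ_) (nonclosing? p) {xs = extensions p} i =
    candidate (arc-extend arc x≁z (proj₂ (∈-filter⁻ (extends? p) {xs = allFin n} j)))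
      (¬cl ∘ Maybe.just)

  newPaths-length : q ∈ newPaths p → length q ≡ suc (length p)
  newPaths-length {p = p} i with v , _ , refl ← ∈-map⁻ (p ∷ʳ_) i =
    trans (length-++ p) (ℕ.+-comm (length p) 1)

  newCycles-chordless : Candidate p → q ∈ newCycles p → IsChordlessCycle G q
  newCycles-chordless {p = p} (candidate arc x≁z) i
    with v , j , refl , Maybe.just x~v ← ∈-map∘filter⁻ (p ∷ʳ_) (closes? p) {xs = extensions p} i =
    closed-arc (arc-extend arc x≁z (proj₂ (∈-filter⁻ (extends? p) {xs = allFin n} j)))
      (~-sym x~v)

  record Sound (s : State) : Set where
    field
      candidates : p ∈ proj₁ s → Candidate p
      cycles     : c ∈ proj₂ s → IsChordlessCycle G c

  ordered : ∀ {t} → t ∈ orderedTriples → Ordered t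
  ordered i =
    proj₂ (∈-filter⁻ ordered?
      {xs = cartesianProduct (allFin n) (cartesianProduct (allFin n) (allFin n))} i)

  initial-sound : Sound initial
  initial-sound = record { candidates = candidates ; cycles = cycles }
    where
    candidates : p ∈ proj₁ initial → Candidate p
    candidates i with t , j , refl , x≁y ← ∈-map∘filter⁻ toPath endsNonadjacent? {xs = orderedTriples} i =
      candidate (triple-arc (ordered j)) x≁y
    cycles : c ∈ proj₂ initial → IsChordlessCycle G c
    cycles i with t , j , refl , x~y ← ∈-map∘filter⁻ toPath endsAdjacent? {xs = orderedTriples} i =
      closed-arc (triple-arc (ordered j)) (~-sym x~y)

  step-sound : ∀ {s s′} → Sound s → s ⟶ s′ → Sound s′
  step-sound sound (iterate {T = T} {C = C} p p∈T) =
    record { candidates = candidates′ ; cycles = cycles′ }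
    where
    open Sound sound
    candidates′ : q ∈ remove p T ++ newPaths p → Candidate q
    candidates′ i with ∈-++⁻ (remove p T) i
    ... | inj₁ j = candidates (proj₁ (∈-filter⁻ (≢? p) j))
    ... | inj₂ j = newPaths-candidate (candidates p∈T) j
    cycles′ : c ∈ C ++ newCycles p → IsChordlessCycle G c
    cycles′ i with ∈-++⁻ C i
    ... | inj₁ j = cycles j
    ... | inj₂ j = newCycles-chordless (candidates p∈T) j

  star-sound : ∀ {s s′} → Sound s → Star _⟶_ s s′ → Sound s′
  star-sound sound ε        = sound
  star-sound sound (r ◅ rs) = star-sound (step-sound sound r) rs

  -- Termination

  -- At most n paths replace p, each of weight (n + 1)⁻¹ times that of p.
  weight : Path G → ℕ
  weight p = suc n ^ (n ∸ length p)

  total : List (Path G) → ℕ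
  total T = sum (map weight T)

  weight>0 : ∀ p → 0 < weight p
  weight>0 p = ℕ.m^n>0 (suc n) (n ∸ length p)

  weight-newPath : Candidate p → q ∈ newPaths p → suc n * weight q ≤ weight p
  weight-newPath {p = p} {q = q} cand i = ℕ.≤-reflexive (cong (suc n ^_) (begin
    suc (n ∸ length q)        ≡⟨ cong (λ k → suc (n ∸ k)) |q| ⟩
    -- The new path repeats no vertex, so its length is at most `n` and the truncated subtraction is
    -- exact.
    suc (n ∸ suc (length p))  ≡⟨ ℕ.+-∸-assoc 1 (subst (_≤ n) |q| (unique-length≤ (candidate-unique (newPaths-candidate cand i)))) ⟨
    n ∸ length p              ∎))
    where
    open ≡-Reasoning
    |q| = newPaths-length i

  newPaths-bounded : ∀ p → length (newPaths p) ≤ n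
  newPaths-bounded p = begin
    length (newPaths p)           ≡⟨ length-map (p ∷ʳ_) open-extensions ⟩
    length open-extensions        ≤⟨ length-filter (nonclosing? p) (extensions p) ⟩
    length (extensions p)         ≤⟨ length-filter (extends? p) (allFin n) ⟩
    length (allFin n)             ≡⟨ length-tabulate id ⟩
    n                             ∎
    where
    open ≤-Reasoning
    open-extensions = filter (nonclosing? p) (extensions p)

  total-newPaths : Candidate p → total (newPaths p) < weight p
  total-newPaths {p = p} cand =
    sum-< (All.map⁺ (All.tabulate (weight-newPath cand)))
      (subst (_≤ n) (sym (length-map weight (newPaths p))) (newPaths-bounded p))
      (weight>0 p)

  total-remove≤ : ∀ p T → total (remove p T) ≤ total T
  total-remove≤ p [] = z≤n
  total-remove≤ p (q ∷ T) with ≡-dec Fin._≟_ q p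
  ... | yes _ = ℕ.≤-trans (total-remove≤ p T) (ℕ.m≤n+m _ (weight q))
  ... | no _  = ℕ.+-monoʳ-≤ (weight q) (total-remove≤ p T)

  -- Only an inequality, since `remove` deletes every occurrence of `p` and just one is accounted
  -- for.
  total-remove : p ∈ T → total (remove p T) + weight p ≤ total T
  total-remove {p = p} {T = q ∷ T} i with ≡-dec Fin._≟_ q p
  ... | yes refl = ℕ.≤-trans (ℕ.+-monoˡ-≤ (weight p) (total-remove≤ p T))
                     (ℕ.≤-reflexive (ℕ.+-comm (total T) (weight p)))
  total-remove (here refl) | no q≢p = ⊥-elim (q≢p refl)
  total-remove {p = p} {T = q ∷ T} (there i) | no _ =
    ℕ.≤-trans (ℕ.≤-reflexive (ℕ.+-assoc (weight q) _ (weight p)))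
      (ℕ.+-monoʳ-≤ (weight q) (total-remove i))

  total-step : Candidate p → p ∈ T → total (remove p T ++ newPaths p) < total T
  total-step {p = p} {T = T} cand p∈T = begin-strict
    total (remove p T ++ newPaths p)           ≡⟨ cong sum (map-++ weight (remove p T) (newPaths p)) ⟩
    sum (map weight (remove p T) ++ map weight (newPaths p))
                                               ≡⟨ sum-++ (map weight (remove p T)) _ ⟩
    total (remove p T) + total (newPaths p)    <⟨ ℕ.+-monoʳ-< (total (remove p T)) (total-newPaths cand) ⟩
    total (remove p T) + weight p              ≤⟨ total-remove p∈T ⟩
    total T                                    ∎
    where open ≤-Reasoning

  -- Soundness travels with the induction on `total`, because the total is shown to drop only when a
  -- candidate is processed.
  sound-acc : ∀ {s} → Sound s → Acc _<_ (total (proj₁ s)) → Acc (flip _⟶_) s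
  sound-acc sound (acc rec) = acc λ where
    r@(iterate p p∈T) →
      sound-acc (step-sound sound r) (rec (total-step (Sound.candidates sound p∈T) p∈T))

  -- Completeness

  -- The list is returned split at its minimum, ready to be rotated there. Distinctness makes all
  -- comparisons strict.
  least : ∀ x p → Unique (x ∷ p) →
          ∃[ as ] ∃[ u ] ∃[ bs ] x ∷ p ≡ as ++ u ∷ bs × All (u ≺_) (as ++ bs)
  least x []      _ = [] , x , [] , refl , []
  least x (y ∷ p) uniq@(_ ∷ uniq′) with as , u , bs , eq , min ← least y p uniq′
    with ≺-connex (λ x≡u → unique-∉ uniq (subst₂ _∈_ (sym x≡u) (sym eq) (∈-++⁺ʳ as (here refl))))
  ... | inj₂ u≺x = x ∷ as , u , bs , cong (x ∷_) eq , u≺x ∷ min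
  ... | inj₁ x≺u = [] , x , y ∷ p , refl ,
    subst (All (x ≺_)) (sym eq)
      (All-resp-↭ (↭-sym (shift u as bs)) (x≺u ∷ All.map (Fin.<-trans x≺u) min))

  -- The last vertex moves to the front, because the initial triples carry their least label in the
  -- middle. Length at least 3 makes `z` and `y` separate entries of `e`.
  rotate-to-second : ∀ u e → 3 ≤ length (u ∷ e) →
                     ∃[ z ] ∃[ y ] ∃[ g ] Rotation G (u ∷ e) (z ∷ u ∷ y ∷ g) × e ↭ z ∷ y ∷ g
  rotate-to-second u e len with initLast e
  rotate-to-second u _ (s≤s ()) | []
  rotate-to-second u _ (s≤s (s≤s ())) | [] ∷ʳ′ z
  rotate-to-second u _ len | (y ∷ g) ∷ʳ′ z =
    z , y , g , (u ∷ y ∷ g , z ∷ [] , refl , refl) , ↭-sym (∷↭∷ʳ z (y ∷ g))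

  record Canonical (x u y : Fin n) (r : Path G) : Set where
    field
      cycle : IsChordlessCycle G (x ∷ u ∷ y ∷ r)
      u≺x   : u ≺ x
      x≺y   : x ≺ y
      later : All (u ≺_) (y ∷ r)

  canonical : IsChordlessCycle G c →
              ∃[ x ] ∃[ u ] ∃[ y ] ∃[ r ] SameCycle G c (x ∷ u ∷ y ∷ r) × Canonical x u y r
  canonical {c = []} cc with () ← IsCycle.length≥3 (IsChordlessCycle.isCycle cc)
  canonical {c = a ∷ p} cc
    with as , u , bs , eq , min ←
      least a p (IsSimplePath.distinct (IsCycle.simplePath (IsChordlessCycle.isCycle cc)))
    with z , y , g , rot , perm ←
      rotate-to-second u (bs ++ as)
        (subst (3 ≤_) (trans (cong length eq) (↭-length (↭-++-comm as (u ∷ bs))))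
          (IsCycle.length≥3 (IsChordlessCycle.isCycle cc)))
    = orient (≺-connex z≢y)
    where
    rot′ : Rotation G (a ∷ p) (z ∷ u ∷ y ∷ g)
    rot′ = rotation-trans G (as , u ∷ bs , eq , refl) rot

    cc′ : IsChordlessCycle G (z ∷ u ∷ y ∷ g)
    cc′ = chordlessCycle-rotate G cc rot′

    z≢y : z ≢ y
    z≢y e = unique-∉ (IsSimplePath.distinct (IsCycle.simplePath (IsChordlessCycle.isCycle cc′)))
              (there (here e))

    min′ : All (u ≺_) (z ∷ y ∷ g)
    min′ = All-resp-↭ (↭-trans (↭-++-comm as bs) perm) min

    -- Reversal alone leaves `y`, `u`, `z` at the end; rotating past `reverse g` brings them to the
    -- front.
    flipped : Rotation G (reverse (z ∷ u ∷ y ∷ g)) (y ∷ u ∷ z ∷ reverse g)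
    flipped = reverse g , y ∷ u ∷ z ∷ [] , reverse-++ (z ∷ u ∷ y ∷ []) g , refl

    orient : z ≺ y ⊎ y ≺ z →
             ∃[ x ] ∃[ u ] ∃[ y ] ∃[ r ] SameCycle G (a ∷ p) (x ∷ u ∷ y ∷ r) × Canonical x u y r
    orient (inj₁ z≺y) = z , u , y , g , inj₁ rot′ , record
      { cycle = cc′
      ; u≺x   = All.head min′
      ; x≺y   = z≺y
      ; later = All.tail min′
      }
    orient (inj₂ y≺z) =
      y , u , z , reverse g ,
      inj₂ (rotation-trans G (rotation-reverse G rot′) flipped) , record
        { cycle = chordlessCycle-rotate G (chordlessCycle-reverse G cc′) flipped
        ; u≺x   = All.head (All.tail min′)
        ; x≺y   = y≺z
        ; later = All.head min′ ∷
                  All-resp-↭ (↭-sym (↭-reverse g)) (All.tail (All.tail min′))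
        }

  -- Following one cycle through the loop.

  module _ {x u y : Fin n} {r : Path G} (can : Canonical x u y r) where
    open Canonical can

    -- The completeness invariant: the cycle is already in `C`, or a proper prefix of it with at
    -- least three vertices waits in `T`, with `v` the next vertex.
    data Reached (T C : List (Path G)) : Set where
      found : x ∷ u ∷ y ∷ r ∈ C → Reached T C
      under : ∀ m z v s → x ∷ u ∷ m ∷ʳ z ∈ T →
              x ∷ u ∷ y ∷ r ≡ (x ∷ u ∷ m ∷ʳ z) ++ v ∷ s → Reached T C

    -- The three tests follow from consecutiveness on the cycle, minimality of the label of `u`, and
    -- absence of chords, respectively.
    prefix-extends : x ∷ u ∷ y ∷ r ≡ (x ∷ u ∷ m ∷ʳ z) ++ v ∷ q →
                     Extends (x ∷ u ∷ m ∷ʳ z) v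
    prefix-extends {m = m} {z = z} {v = v} {q = q} eq =
      subst (Maybe.Any (_~ v)) (sym (last-∷ʳ (x ∷ u ∷ m))) (Maybe.just z~v) ,
      Maybe.just u≺v ,
      subst (All _) (sym (interior-∷-∷ʳ x (u ∷ m) z)) (All.tabulate ≁v)
      where
      tail-eq : y ∷ r ≡ m ∷ʳ z ++ v ∷ q
      tail-eq = ∷-injectiveʳ (∷-injectiveʳ eq)

      z~v : z ~ v
      z~v = cycleEdge-adjacent G cycle
        (inj₁ (inj₁ (x ∷ u ∷ m , q , trans eq (∷ʳ-++ (x ∷ u ∷ m) z (v ∷ q)))))

      u≺v : u ≺ v
      u≺v = All.lookup later (subst (v ∈_) (sym tail-eq) (∈-++⁺ʳ (m ∷ʳ z) (here refl)))

      ≁v : w ∈ u ∷ m → ¬ w ~ v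
      ≁v {w = w} i with as , bs , e ← ∈-∃++ i = separated bs (trans eq (cong (x ∷_) (begin
          (u ∷ m) ∷ʳ z ++ v ∷ q             ≡⟨ ∷ʳ-++ (u ∷ m) z (v ∷ q) ⟩
          (u ∷ m) ++ z ∷ v ∷ q              ≡⟨ cong (_++ z ∷ v ∷ q) e ⟩
          (as ++ w ∷ bs) ++ z ∷ v ∷ q       ≡⟨ ++-assoc as (w ∷ bs) _ ⟩
          as ++ w ∷ bs ++ z ∷ v ∷ q         ∎)))
        where
        open ≡-Reasoning
        -- At least `z` lies between `w` and `v`; splitting `bs` exposes the vertex right after `w`.
        -- Since `x` stands before `w`, the two are not the closing pair.
        separated : ∀ bs → x ∷ u ∷ y ∷ r ≡ x ∷ as ++ w ∷ bs ++ z ∷ v ∷ q → ¬ w ~ v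
        separated []       eq = separated⇒≁ G cycle (x ∷ as) [] eq λ ()
        separated (b ∷ bs) eq =
          separated⇒≁ G cycle (x ∷ as) (bs ∷ʳ z)
            (trans eq (cong (λ k → x ∷ as ++ w ∷ b ∷ k) (sym (∷ʳ-++ bs z (v ∷ q))))) λ ()

    -- If `v` completes the cycle, it is adjacent to `x` and the cycle enters `C`. Otherwise an edge
    -- between `x` and `v` would be a chord, so the longer prefix enters `T`.
    reached-extension : ∀ m z v s → x ∷ u ∷ y ∷ r ≡ (x ∷ u ∷ m ∷ʳ z) ++ v ∷ s →
                        let p = x ∷ u ∷ m ∷ʳ z in
                        Reached (remove p T ++ newPaths p) (C ++ newCycles p)
    reached-extension {T = T} {C = C} m z v [] eq =
      found (∈-++⁺ʳ C (∈-map∘filter⁺ (p₀ ∷ʳ_) (closes? p₀)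
        (v , ∈-filter⁺ (extends? p₀) (∈-allFin v) (prefix-extends eq) , eq , Maybe.just x~v)))
      where
      p₀ = x ∷ u ∷ m ∷ʳ z
      x~v : x ~ v
      x~v = ~-sym (cycleEdge-adjacent G cycle
        (inj₁ (inj₂ (trans (cong last eq) (last-∷ʳ p₀) , refl))))
    reached-extension {T = T} {C = C} m z v (v′ ∷ s) eq =
      under (m ∷ʳ z) v v′ s
        (∈-++⁺ʳ (remove p₀ T) (∈-map∘filter⁺ (p₀ ∷ʳ_) (nonclosing? p₀)
          (v , ∈-filter⁺ (extends? p₀) (∈-allFin v) (prefix-extends eq) , refl ,
           λ where (Maybe.just x~v) → x≁v x~v)))
        (trans eq (sym (∷ʳ-++ p₀ v (v′ ∷ s))))
      where
      p₀ = x ∷ u ∷ m ∷ʳ z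
      x≁v : ¬ x ~ v
      x≁v = separated⇒≁ G cycle [] (m ∷ʳ z) eq λ ()

    reached-step : ∀ {T C T′ C′} → Reached T C → (T , C) ⟶ (T′ , C′) → Reached T′ C′
    reached-step (found i) (iterate p p∈T) = found (∈-++⁺ˡ i)
    reached-step {T = T} {C = C} (under m z v s i eq) (iterate p p∈T)
      with ≡-dec Fin._≟_ (x ∷ u ∷ m ∷ʳ z) p
    ... | yes refl = reached-extension {T = T} {C = C} m z v s eq
    ... | no q≢p   = under m z v s (∈-++⁺ˡ (∈-filter⁺ (≢? p) i q≢p)) eq

    reached-star : ∀ {T C T′ C′} → Reached T C → Star _⟶_ (T , C) (T′ , C′) → Reached T′ C′
    reached-star h ε                        = h
    reached-star h (_◅_ {j = _ , _} t ts)   = reached-star (reached-step h t) ts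

    triple∈ : (x , u , y) ∈ orderedTriples
    triple∈ = ∈-filter⁺ ordered?
      (∈-cartesianProduct⁺ (∈-allFin x) (∈-cartesianProduct⁺ (∈-allFin u) (∈-allFin y)))
      (( ~-sym (cycleEdge-adjacent G cycle (inj₁ (inj₁ ([] , y ∷ r , refl))))
       , cycleEdge-adjacent G cycle (inj₁ (inj₁ (x ∷ [] , r , refl)))) , u≺x , x≺y)

  -- A triangle is in `C` from the start. In a longer cycle `x` and `y` are not adjacent, as their
  -- edge would be a chord, so the triple starts in `T`.
  initial-reached : ∀ {x u y r} (can : Canonical x u y r) →
                    Reached can (proj₁ initial) (proj₂ initial)
  initial-reached {x} {u} {y} {[]} can =
    found (∈-map∘filter⁺ toPath endsAdjacent? ((x , u , y) , triple∈ can , refl ,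
      ~-sym (cycleEdge-adjacent G (Canonical.cycle can) (inj₁ (inj₂ (refl , refl))))))
  initial-reached {x} {u} {y} {v ∷ r} can =
    under [] y v r (∈-map∘filter⁺ toPath endsNonadjacent? ((x , u , y) , triple∈ can , refl ,
      separated⇒≁ G (Canonical.cycle can) [] [] refl λ ())) refl

  -- Once `T` is empty no prefix can be waiting, so only `found` remains.
  canonical-returned : ∀ {x u y r} → Canonical x u y r → Returns C → x ∷ u ∷ y ∷ r ∈ C
  canonical-returned can run with reached-star can (initial-reached can) run
  ... | found i = i

theorem1 : (n : ℕ) (G : Graph n) (ℓ : Labeling G) → IsDegreeLabeling G ℓ →
    Algorithm.Terminates G ℓ ×
    ((C : List (Path G)) → Algorithm.Returns G ℓ C → EnumeratesChordlessCycles G C)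
theorem1 n G ℓ _ =
  sound-acc G ℓ (initial-sound G ℓ) (<-wellFounded _) ,
  λ C run →
    (λ c i → Sound.cycles (star-sound G ℓ (initial-sound G ℓ) run) i) ,
    λ c cc → let x , u , y , r , same , can = canonical G ℓ cc in
             x ∷ u ∷ y ∷ r , canonical-returned G ℓ can run , same
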